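{- Let $\varepsilon>0$ be a constant. On every finite simple undirected graph with $n$ vertices, ADG performs $O(\log n)$ iterations of its main loop and has $O(\log^2 n)$ depth in the CRCW setting.
   Context: Cost model: a parallel computation is a directed acyclic graph (DAG) of constant-time operations; its work is the number of nodes and its depth is the length of the longest directed path. In the CRCW setting concurrent reads, concurrent writes and atomic read-modify-write operations (e.g. atomic decrement-and-fetch) to the same memory cell take $O(1)$ time. Summing (Reduce) or counting (Count) over an array of size $N$ takes $O(\log N)$ depth and $O(N)$ work. Hidden constants may depend on $\varepsilon$; $\log n$ is read as $\max\{1,\log n\}$. For $U\subseteq V$, $N_U(v)$ denotes the set of neighbors of $v$ in $U$. Algorithm ADG (parameter $\varepsilon$, input $G=(V,E)$). Initialize $U=V$, $D[v]=\deg(v)$ for all $v$, $\ell=1$. While $U\neq\emptyset$: compute $|U|$ by Count and $\sum_{v\in U}D[v]$ by Reduce, and $\widehat\delta=\frac1{|U|}\sum_{v\in U}D[v]$; set $R=\{u\in U: D[u]\le(1+\varepsilon)\widehat\delta\}$; for all $v\in R$ and all $u\in N_U(v)$ in parallel, atomically decrement $D[u]$; set $U=U\setminus R$; set $\rho_{\mathrm{ADG}}(v)=\ell$ for all $v\in R$ in parallel; set $\ell=\ell+1$. $D$ is an array and $U,R$ are bitmaps over $V$. -}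

module Defs where

open import Level using (Level; 0ℓ) renaming (suc to lsuc; _⊔_ to _⊔ˡ_)
open import Algebra.Bundles using (CommutativeRing)
import Algebra.Definitions.RawMonoid as RawMonoidDefinitions
open import Data.Bool.Base using (Bool; true; false; if_then_else_; _∧_)
open import Data.Empty using (⊥)
open import Data.Fin.Base using (Fin)
open import Data.List.Base using (List; []; _∷_; allFin; filter; head; length)
open import Data.Maybe.Base using (fromMaybe)
open import Data.Nat.Base as ℕ using (ℕ; zero; suc; _⊔_)
open import Data.Nat.Logarithm using (⌊log₂_⌋; ⌈log₂_⌉)
open import Data.Product.Base using (∃; _×_; _,_)
open import Data.Sum.Base using (_⊎_; inj₁; inj₂)
open import Data.Unit.Base using (⊤; tt)
open import Data.Vec.Functional using (Vector; updateAt)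
open import Function.Base using (const)
open import Relation.Binary.Core using (Rel)
open import Relation.Binary.Definitions using (Decidable; Irreflexive; Symmetric)
import Relation.Binary.Construct.NonStrictToStrict as NonStrictToStrict
open import Relation.Binary.PropositionalEquality.Core using (_≡_)
open import Relation.Binary.Structures using (IsDecTotalOrder)
open import Relation.Nullary.Decidable.Core using (⌊_⌋)
open import Relation.Nullary.Negation.Core using (¬_)

private variable
  a b : Level
  A : Set a
  B : Set b

log : ℕ → ℕ
log n = 1 ⊔ ⌊log₂ n ⌋

-- The real numbers enter only through this interface: classically ℝ is an
-- instance.  Decidability of the order is needed since the algorithm branches
-- on comparisons of reals.  The inverse is total, with an unspecified value
-- at zero.
record ArchimedeanField c ℓ₁ ℓ₂ : Set (lsuc (c ⊔ˡ ℓ₁ ⊔ˡ ℓ₂)) where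
  field
    commutativeRing : CommutativeRing c ℓ₁
  open CommutativeRing commutativeRing public
  open RawMonoidDefinitions +-rawMonoid using () renaming (_×_ to _·_)

  fromℕ : ℕ → Carrier
  fromℕ n = n · 1#

  infix 4 _≤_
  infix 8 _⁻¹
  field
    _≤_             : Rel Carrier ℓ₂
    isDecTotalOrder : IsDecTotalOrder _≈_ _≤_
    +-monoˡ-≤       : ∀ z {x y} → x ≤ y → x + z ≤ y + z
    *-nonNegative   : ∀ {x y} → 0# ≤ x → 0# ≤ y → 0# ≤ x * y
    _⁻¹             : Carrier → Carrier
    *-inverseʳ      : ∀ x → ¬ x ≈ 0# → x * x ⁻¹ ≈ 1#
    0≉1             : ¬ 0# ≈ 1#
    archimedean     : ∀ x → ∃ λ n → x ≤ fromℕ n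

  open IsDecTotalOrder isDecTotalOrder public using (_≤?_)
  open NonStrictToStrict _≈_ _≤_ public using (_<_)

record SimpleGraph (n : ℕ) : Set₁ where
  field
    Adj        : Rel (Fin n) 0ℓ
    adj?       : Decidable Adj
    adj-sym    : Symmetric Adj
    adj-irrefl : Irreflexive _≡_ Adj

  neighbours : Fin n → List (Fin n)
  neighbours v = filter (adj? v) (allFin n)

-- Series-parallel descriptions of computation DAGs; the DAG itself is given by
-- Node and Edge.
infixr 5 _⨾_
infixr 6 _∥_
data Dag : Set where
  empty operation : Dag
  _⨾_ _∥_         : Dag → Dag → Dag

Node : Dag → Set
Node empty     = ⊥
Node operation = ⊤
Node (d ⨾ e)   = Node d ⊎ Node e
Node (d ∥ e)   = Node d ⊎ Node e

-- In d ⨾ e every node of d precedes every node of e.  Compared with joining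
-- only sinks to sources, this adds transitive edges, which do not change the
-- longest paths.
data Edge : (d : Dag) → Node d → Node d → Set where
  seqˡ   : ∀ {d e x y} → Edge d x y → Edge (d ⨾ e) (inj₁ x) (inj₁ y)
  seqʳ   : ∀ {d e x y} → Edge e x y → Edge (d ⨾ e) (inj₂ x) (inj₂ y)
  across : ∀ {d e x y} → Edge (d ⨾ e) (inj₁ x) (inj₂ y)
  parˡ   : ∀ {d e x y} → Edge d x y → Edge (d ∥ e) (inj₁ x) (inj₁ y)
  parʳ   : ∀ {d e x y} → Edge e x y → Edge (d ∥ e) (inj₂ x) (inj₂ y)

-- Directed paths from a given node, indexed by their number of nodes (one more
-- than the number of edges).
data Path (d : Dag) : Node d → ℕ → Set where
  stop : ∀ x → Path d x 1
  step : ∀ {x y k} → Edge d x y → Path d y k → Path d x (suc k)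

DepthAtMost : ℕ → Dag → Set
DepthAtMost b d = ∀ x k → Path d x k → k ℕ.≤ b

record Memory (n : ℕ) : Set where
  field
    D ρ : Vector ℕ n
    U R : Vector Bool n
    ℓ   : ℕ

-- A program transforms the shared memory and returns a value together with the
-- DAG of the operations it executed.
module Machine (n : ℕ) where
  open Memory

  M : Set a → Set a
  M A = Memory n → A × Memory n × Dag

  return : A → M A
  return x m = x , m , empty

  infixl 1 _>>=_ _>>_
  _>>=_ : M A → (A → M B) → M B
  (p >>= f) m =
    let x , m₁ , d₁ = p m
        y , m₂ , d₂ = f x m₁
    in  y , m₂ , d₁ ⨾ d₂

  _>>_ : M A → M B → M B
  p >> q = p >>= const q

  -- Memory effects are executed in list order, which is one legal interleaving
  -- of the parallel branches.  It is used only where all interleavings agree: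
  -- branches write to distinct cells that no other branch reads, or they
  -- perform commuting decrements of cells that none of them reads.
  parMap : (A → M B) → List A → M (List B)
  parMap f []       m = [] , m , empty
  parMap f (x ∷ xs) m =
    let y  , m₁ , d  = f x m
        ys , m₂ , ds = parMap f xs m₁
    in  y ∷ ys , m₂ , d ∥ ds

  forAll : List A → (A → M ⊤) → M ⊤
  forAll xs f = parMap f xs >> return tt

  when : Bool → M ⊤ → M ⊤
  when c p = if c then p else return tt

  -- Constant-time operations: local arithmetic, and an access to one cell.

  compute : A → M A
  compute x m = x , m , operation

  readD : Fin n → M ℕ
  readD v m = D m v , m , operation

  readU readR : Fin n → M Bool
  readU v m = U m v , m , operation
  readR v m = R m v , m , operation

  readℓ : M ℕ
  readℓ m = ℓ m , m , operation

  writeD writeρ : Fin n → ℕ → M ⊤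
  writeD v x m = tt , record m { D = updateAt (D m) v (const x) } , operation
  writeρ v x m = tt , record m { ρ = updateAt (ρ m) v (const x) } , operation

  writeU writeR : Fin n → Bool → M ⊤
  writeU v x m = tt , record m { U = updateAt (U m) v (const x) } , operation
  writeR v x m = tt , record m { R = updateAt (R m) v (const x) } , operation

  writeℓ : ℕ → M ⊤
  writeℓ x m = tt , record m { ℓ = x } , operation

  -- Truncation at zero is harmless: ADG keeps D u ≥ |N_U(u)| for u ∈ U.
  decrementD : Fin n → M ⊤
  decrementD u m = tt , record m { D = updateAt (D m) u ℕ.pred } , operation

  pairUp : List ℕ → List (ℕ × ℕ)
  pairUp []           = []
  pairUp (x ∷ [])     = (x , 0) ∷ []
  pairUp (x ∷ y ∷ xs) = (x , y) ∷ pairUp xs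

  reduceRounds : ℕ → List ℕ → M (List ℕ)
  reduceRounds zero    xs = return xs
  reduceRounds (suc k) xs =
    parMap (λ (x , y) → compute (x ℕ.+ y)) (pairUp xs) >>= reduceRounds k

  -- Summation along a balanced binary tree: the rounds leave at most one entry.
  reduce : List ℕ → M ℕ
  reduce xs = do
    ys ← reduceRounds ⌈log₂ length xs ⌉ xs
    return (fromMaybe 0 (head ys))

  -- While guard body m k m′ d: started in memory m, the loop terminates in m′
  -- after exactly k iterations of the body, having executed d.
  data While (guard : M Bool) (body : M ⊤) :
             Memory n → ℕ → Memory n → Dag → Set where
    exit    : ∀ {m m′ d} → guard m ≡ (false , m′ , d) →
              While guard body m 0 m′ d
    iterate : ∀ {m m₁ m₂ m₃ k d₁ d₂ d₃} →
              guard m ≡ (true , m₁ , d₁) →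
              body m₁ ≡ (tt , m₂ , d₂) →
              While guard body m₂ k m₃ d₃ →
              While guard body m (suc k) m₃ (d₁ ⨾ d₂ ⨾ d₃)

module Algorithm {c ℓ₁ ℓ₂} (K : ArchimedeanField c ℓ₁ ℓ₂)
                 (ε : ArchimedeanField.Carrier K)
                 {n : ℕ} (G : SimpleGraph n) where
  open ArchimedeanField K using (1#; _+_; _*_; _⁻¹; fromℕ; _≤?_)
  open SimpleGraph G using (neighbours)
  open Machine n public

  V : List (Fin n)
  V = allFin n

  -- The degree is obtained by counting the adjacency list.
  degree : Fin n → M ℕ
  degree v = parMap (λ _ → compute 1) (neighbours v) >>= reduce

  countU : M ℕ
  countU = parMap indicator V >>= reduce
    where
    indicator : Fin n → M ℕ
    indicator v = do
      inU ← readU v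
      compute (if inU then 1 else 0)

  sumDOverU : M ℕ
  sumDOverU = parMap summand V >>= reduce
    where
    summand : Fin n → M ℕ
    summand v = do
      inU ← readU v
      d   ← readD v
      compute (if inU then d else 0)

  initialize : M ⊤
  initialize = do
    forAll V λ v → writeU v true
    forAll V λ v → degree v >>= writeD v
    writeℓ 1

  nonEmptyU : M Bool
  nonEmptyU = do
    size ← countU
    compute (0 ℕ.<ᵇ size)

  body : M ⊤
  body = do
    size ← countU
    sumD ← sumDOverU
    δ̂ ← compute (fromℕ size ⁻¹ * fromℕ sumD)
    forAll V λ u → do
      inU ← readU u
      d   ← readD u
      low ← compute ⌊ fromℕ d ≤? (1# + ε) * δ̂ ⌋
      writeR u (inU ∧ low)
    forAll V λ v → do
      inR ← readR v
      when inR (forAll (neighbours v) λ u → do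
        inU ← readU u
        when inU (decrementD u))
    forAll V λ v → do
      inR ← readR v
      when inR (writeU v false)
    level ← readℓ
    forAll V λ v → do
      inR ← readR v
      when inR (writeρ v level)
    writeℓ (suc level)

  -- ADG m k m′ d: started in memory m (with arbitrary contents), ADG terminates
  -- in memory m′ after exactly k iterations of its main loop, having executed d.
  data ADG (m : Memory n) : ℕ → Memory n → Dag → Set where
    run : ∀ {m₁ m₂ k d₁ d₂} →
          initialize m ≡ (tt , m₁ , d₁) →
          While nonEmptyU body m₁ k m₂ d₂ →
          ADG m k m₂ (d₁ ⨾ d₂)

{-# OPTIONS --safe #-}

-- Let s = |U|, let S be the sum of D over U, and let t be the number of vertices that survive an
-- iteration.  Each survivor has D u > (1 + ε) S / s, and these values sum to at most S (Markov's
-- inequality), so t ≤ s / (1 + ε).  This uses nothing about D, so the decrements need not be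
-- tracked.  With a natural number N ≥ 1/ε (the order is Archimedean), t (N + 1) ≤ s N, and since
-- (1 + 1/N) ^ N ≥ 2, the loop exits within N (1 + ⌊log₂ n⌋) iterations.  Besides loops of
-- constant depth an iteration performs two reductions, of ⌈log₂ n⌉ rounds each, and the loop test
-- performs one more.

module Submission where

open import Defs
import Algebra.Properties.CommutativeSemigroup as CommutativeSemigroupProperties
import Algebra.Properties.Ring as RingProperties
import Algebra.Properties.Semiring.Mult as Multiples
open import Data.Bool.Base using (Bool; true; false; if_then_else_; _∧_)
open import Data.Fin.Base using (Fin)
import Data.Fin.Properties as Fin
open import Data.List.Base using (List; []; _∷_; head; length; map)
open import Data.List.Membership.Propositional.Properties using (∈-allFin)
import Data.List.Properties as List
open import Data.List.Relation.Unary.All as All using (All; []; _∷_)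
open import Data.Maybe.Base using (fromMaybe)
open import Data.Nat.Base as ℕ
  using (ℕ; zero; suc; _≤_; _⊔_; _∸_; _^_; ⌈_/2⌉; z≤n; s≤s; NonZero)
open import Data.Nat.ListAction using (sum)
open import Data.Nat.Logarithm
  using (⌊log₂_⌋; ⌈log₂_⌉; ⌊log₂⌋-mono-≤; ⌈log₂⌉-mono-≤; ⌊log₂[2^n]⌋≡n; ⌈log₂2^n⌉≡n;
         ⌈log₂⌈n/2⌉⌉≡⌈log₂n⌉∸1)
open import Data.Nat.Properties as ℕ
  using (module ≤-Reasoning; m≤m⊔n; m≤n⊔m; ⊔-lub;
         *-cancelˡ-<; *-cancelˡ-≤; *-distribʳ-+;
         *-mono-≤; *-monoʳ-<; *-monoʳ-≤; *-suc; *-zeroʳ; +-assoc; +-comm; +-identityʳ;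
         +-mono-≤; +-monoˡ-≤; 1+n≰n; <⇒≤; ^-distribˡ-+-*; m*n≢0; m^n≢0;
         m≤m+n; m≤n+m; n≤0⇒n≡0; n≤1+n; ∸-monoˡ-≤; ≤-<-trans; ≤-refl; ≤-reflexive; ≤-trans; ≮⇒≥;
         ≰⇒>)
open import Data.Nat.Tactic.RingSolver using (solve-∀)
open import Data.Product.Base using (∃-syntax; _×_; _,_; proj₁; proj₂)
open import Data.Sum.Base using (inj₁; inj₂)
open import Data.Unit.Base using (⊤)
open import Data.Vec.Functional using (Vector; updateAt)
open import Data.Vec.Functional.Properties using (updateAt-updates; updateAt-minimal)
open import Function.Base using (_∘_; const; id)
open import Level using (Level)
open import Relation.Binary.Bundles using (Preorder)
import Relation.Binary.Reasoning.Preorder as PreorderReasoning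
open import Relation.Binary.PropositionalEquality
  using (_≡_; refl; sym; trans; cong; cong₂; subst)
import Relation.Binary.Structures as Structures
open import Relation.Nullary.Decidable using (yes; no; ⌊_⌋; dec-true; isYes≗does)
open import Relation.Nullary.Negation using (¬_; contradiction)

-- Arithmetic in an Archimedean ordered field.

module OrderedField {c ℓ₁ ℓ₂} (K : ArchimedeanField c ℓ₁ ℓ₂) where
  module K = ArchimedeanField K
  open K
    using (Carrier; _≈_; 0#; 1#; _+_; _*_; -_; _⁻¹; fromℕ; +-cong; *-comm;
      *-congʳ; *-congˡ; *-assoc; *-identityʳ; *-identityˡ; distribʳ)
    renaming (_≤_ to _≤ᴷ_)
  open Structures.IsDecTotalOrder K.isDecTotalOrder
    using (total; antisym; reflexive; isPreorder)
    renaming (refl to ≤ᴷ-refl; trans to ≤ᴷ-trans)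
  open RingProperties K.ring
  open Multiples K.semiring using (×1-homo-*)

  ≤ᴷ-preorder : Preorder _ _ _
  ≤ᴷ-preorder = record { isPreorder = isPreorder }

  open PreorderReasoning ≤ᴷ-preorder

  0≤y-x : ∀ {x y} → x ≤ᴷ y → 0# ≤ᴷ y + - x
  0≤y-x {x} {y} x≤y = begin
    0#       ≈⟨ K.-‿inverseʳ x ⟨
    x + - x  ∼⟨ K.+-monoˡ-≤ (- x) x≤y ⟩
    y + - x  ∎

  +-mono-≤ᴷ : ∀ {w x y z} → w ≤ᴷ x → y ≤ᴷ z → w + y ≤ᴷ x + z
  +-mono-≤ᴷ {w} {x} {y} {z} w≤x y≤z = begin
    w + y  ∼⟨ K.+-monoˡ-≤ y w≤x ⟩
    x + y  ≈⟨ K.+-comm x y ⟩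
    y + x  ∼⟨ K.+-monoˡ-≤ x y≤z ⟩
    z + x  ≈⟨ K.+-comm z x ⟩
    x + z  ∎

  *-monoˡ-≤ᴷ : ∀ {x y z} → 0# ≤ᴷ z → x ≤ᴷ y → x * z ≤ᴷ y * z
  *-monoˡ-≤ᴷ {x} {y} {z} 0≤z x≤y = begin
    x * z                    ≈⟨ K.+-identityˡ (x * z) ⟨
    0# + x * z               ∼⟨ K.+-monoˡ-≤ (x * z) (K.*-nonNegative (0≤y-x x≤y) 0≤z) ⟩
    (y + - x) * z + x * z    ≈⟨ distribʳ z (y + - x) x ⟨
    ((y + - x) + x) * z      ≈⟨ *-congʳ (K.+-assoc y (- x) x) ⟩
    (y + (- x + x)) * z      ≈⟨ *-congʳ (K.+-congˡ (K.-‿inverseˡ x)) ⟩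
    (y + 0#) * z             ≈⟨ *-congʳ (K.+-identityʳ y) ⟩
    y * z                    ∎

  -- If `1# ≤ᴷ 0#`, then `- 1#` is nonnegative, and so is its square, which is `1#`.
  0≤1 : 0# ≤ᴷ 1#
  0≤1 with total 0# 1#
  ... | inj₁ 0≤1 = 0≤1
  ... | inj₂ 1≤0 = begin
    0#           ∼⟨ K.*-nonNegative 0≤-1 0≤-1 ⟩
    - 1# * - 1#  ≈⟨ -1*x≈-x (- 1#) ⟩
    - - 1#       ≈⟨ -‿involutive 1# ⟩
    1#           ∎
    where
    0≤-1 : 0# ≤ᴷ - 1#
    0≤-1 = begin
      0#         ∼⟨ 0≤y-x 1≤0 ⟩
      0# + - 1#  ≈⟨ K.+-identityˡ (- 1#) ⟩
      - 1#       ∎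

  fromℕ-mono-≤ : ∀ {m n} → m ≤ n → fromℕ m ≤ᴷ fromℕ n
  fromℕ-mono-≤ (z≤n {zero})  = ≤ᴷ-refl
  fromℕ-mono-≤ (z≤n {suc n}) = begin
    0#            ≈⟨ K.+-identityˡ 0# ⟨
    0# + 0#       ∼⟨ +-mono-≤ᴷ 0≤1 (fromℕ-mono-≤ (z≤n {n})) ⟩
    1# + fromℕ n  ∎
  fromℕ-mono-≤ (s≤s m≤n) = +-mono-≤ᴷ ≤ᴷ-refl (fromℕ-mono-≤ m≤n)

  -- Characteristic zero comes from the order: `1#` lies below `fromℕ (suc n)`, so a vanishing
  -- multiple would make `0#` and `1#` equal.
  fromℕ≉0 : ∀ n .{{_ : NonZero n}} → ¬ fromℕ n ≈ 0#
  fromℕ≉0 (suc n) eq = K.0≉1 (antisym 0≤1 (begin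
    1#            ≈⟨ K.+-identityʳ 1# ⟨
    fromℕ 1       ∼⟨ fromℕ-mono-≤ (s≤s (z≤n {n})) ⟩
    fromℕ (suc n) ≈⟨ eq ⟩
    0#            ∎))

  *-cancelʳ-≈ : ∀ {x y z} → ¬ z ≈ 0# → x * z ≈ y * z → x ≈ y
  *-cancelʳ-≈ {x} {y} {z} z≉0 eq = K.trans (K.sym (collapse x)) (K.trans (*-congʳ eq) (collapse y))
    where
    collapse : ∀ w → (w * z) * z ⁻¹ ≈ w
    collapse w =
      K.trans (*-assoc w z (z ⁻¹)) (K.trans (*-congˡ (K.*-inverseʳ z z≉0)) (*-identityʳ w))

  -- By totality only `y ≤ᴷ x` is left to consider; then `x * z` and `y * z` are equal, and the
  -- nonzero `z` cancels.
  *-cancelʳ-≤ᴷ : ∀ {x y z} → 0# ≤ᴷ z → ¬ z ≈ 0# → x * z ≤ᴷ y * z → x ≤ᴷ y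
  *-cancelʳ-≤ᴷ {x} {y} 0≤z z≉0 xz≤yz with total x y
  ... | inj₁ x≤y = x≤y
  ... | inj₂ y≤x = reflexive (*-cancelʳ-≈ z≉0 (antisym xz≤yz (*-monoˡ-≤ᴷ 0≤z y≤x)))

  reciprocal-bound : ∀ {ε} → 0# K.< ε → ∃[ N ] (NonZero N × 1# ≤ᴷ fromℕ N * ε)
  -- Already `fromℕ N` dominates `ε ⁻¹`; the successor makes the natural number visibly nonzero.
  reciprocal-bound {ε} (0≤ε , 0≉ε) = suc N , _ , (begin
    1#                ≈⟨ K.*-inverseʳ ε (0≉ε ∘ K.sym) ⟨
    ε * ε ⁻¹          ≈⟨ *-comm ε (ε ⁻¹) ⟩
    ε ⁻¹ * ε          ∼⟨ *-monoˡ-≤ᴷ 0≤ε (proj₂ (K.archimedean (ε ⁻¹))) ⟩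
    fromℕ N * ε       ∼⟨ *-monoˡ-≤ᴷ 0≤ε (fromℕ-mono-≤ (n≤1+n N)) ⟩
    fromℕ (suc N) * ε ∎)
    where N = proj₁ (K.archimedean (ε ⁻¹))

  -- The threshold test cleared of denominators, with 1/N a lower bound for ε.
  below-threshold : ∀ {ε} N s S d .{{_ : NonZero N}} .{{_ : NonZero s}} →
    1# ≤ᴷ fromℕ N * ε → d ℕ.* (s ℕ.* N) ≤ S ℕ.* suc N →
    fromℕ d ≤ᴷ (1# + ε) * (fromℕ s ⁻¹ * fromℕ S)
  below-threshold {ε} N s S d 1≤Nε dsN≤S[1+N] =
    *-cancelʳ-≤ᴷ (fromℕ-mono-≤ (z≤n {s ℕ.* N})) (fromℕ≉0 (s ℕ.* N) {{m*n≢0 s N}}) (begin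
      fromℕ d * fromℕ (s ℕ.* N)
        ≈⟨ ×1-homo-* d (s ℕ.* N) ⟨
      fromℕ (d ℕ.* (s ℕ.* N))
        ∼⟨ fromℕ-mono-≤ dsN≤S[1+N] ⟩
      fromℕ (S ℕ.* suc N)
        ≈⟨ ×1-homo-* S (suc N) ⟩
      fromℕ S * (1# + fromℕ N)
        ≈⟨ *-comm _ _ ⟩
      (1# + fromℕ N) * fromℕ S
        ∼⟨ *-monoˡ-≤ᴷ (fromℕ-mono-≤ (z≤n {S})) (+-mono-≤ᴷ 1≤Nε ≤ᴷ-refl) ⟩
      (fromℕ N * ε + fromℕ N) * fromℕ S
        ≈⟨ *-congʳ factor ⟩
      ((1# + ε) * fromℕ N) * fromℕ S
        ≈⟨ *-assoc _ _ _ ⟩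
      (1# + ε) * (fromℕ N * fromℕ S)
        ≈⟨ *-congˡ insert-s ⟩
      (1# + ε) * ((fromℕ s ⁻¹ * fromℕ S) * (fromℕ s * fromℕ N))
        ≈⟨ *-assoc _ _ _ ⟨
      ((1# + ε) * (fromℕ s ⁻¹ * fromℕ S)) * (fromℕ s * fromℕ N)
        ≈⟨ *-congˡ (×1-homo-* s N) ⟨
      ((1# + ε) * (fromℕ s ⁻¹ * fromℕ S)) * fromℕ (s ℕ.* N) ∎)
    where
    open CommutativeSemigroupProperties K.*-commutativeSemigroup using (interchange)
    factor : fromℕ N * ε + fromℕ N ≈ (1# + ε) * fromℕ N
    factor = begin-equality
      fromℕ N * ε + fromℕ N        ≈⟨ +-cong (*-comm _ _) (K.sym (*-identityˡ _)) ⟩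
      ε * fromℕ N + 1# * fromℕ N   ≈⟨ distribʳ _ _ _ ⟨
      (ε + 1#) * fromℕ N           ≈⟨ *-congʳ (K.+-comm _ _) ⟩
      (1# + ε) * fromℕ N           ∎
    insert-s : fromℕ N * fromℕ S ≈ (fromℕ s ⁻¹ * fromℕ S) * (fromℕ s * fromℕ N)
    insert-s = begin-equality
      fromℕ N * fromℕ S                              ≈⟨ *-comm _ _ ⟩
      fromℕ S * fromℕ N                              ≈⟨ *-identityˡ _ ⟨
      1# * (fromℕ S * fromℕ N)                       ≈⟨ *-congʳ (K.*-inverseʳ _ (fromℕ≉0 s)) ⟨
      fromℕ s * fromℕ s ⁻¹ * (fromℕ S * fromℕ N)     ≈⟨ *-congʳ (*-comm _ _) ⟩
      fromℕ s ⁻¹ * fromℕ s * (fromℕ S * fromℕ N)     ≈⟨ interchange _ _ _ _ ⟩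
      (fromℕ s ⁻¹ * fromℕ S) * (fromℕ s * fromℕ N)   ∎

-- Binary logarithms and Bernoulli's inequality.

n<2^[1+⌊log₂n⌋] : ∀ n → n ℕ.< 2 ^ suc ⌊log₂ n ⌋
n<2^[1+⌊log₂n⌋] n = ≰⇒> λ 2^≤n → 1+n≰n
  (subst (_≤ ⌊log₂ n ⌋) (⌊log₂[2^n]⌋≡n (suc ⌊log₂ n ⌋)) (⌊log₂⌋-mono-≤ 2^≤n))

⌈log₂⌉≤1+⌊log₂⌋ : ∀ n → ⌈log₂ n ⌉ ≤ suc ⌊log₂ n ⌋
⌈log₂⌉≤1+⌊log₂⌋ n =
  subst (⌈log₂ n ⌉ ≤_) (⌈log₂2^n⌉≡n (suc ⌊log₂ n ⌋)) (⌈log₂⌉-mono-≤ (<⇒≤ (n<2^[1+⌊log₂n⌋] n)))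

1+⌊log₂n⌋≤2*log : ∀ n → suc ⌊log₂ n ⌋ ≤ 2 ℕ.* log n
1+⌊log₂n⌋≤2*log n = +-mono-≤ (m≤m⊔n 1 ⌊log₂ n ⌋) (≤-trans (m≤n⊔m 1 ⌊log₂ n ⌋) (m≤m+n _ 0))

-- Reduction stops when no rounds remain; the list then has at most one entry, because `⌈log₂ 2 ⌉`
-- is already 1.
⌈log₂⌉≤0⇒≤1 : ∀ n → ⌈log₂ n ⌉ ≤ 0 → n ≤ 1
⌈log₂⌉≤0⇒≤1 n log≤0 = ≮⇒≥ λ 2≤n → contradiction (≤-trans (⌈log₂⌉-mono-≤ 2≤n) log≤0) λ ()

-- (1 + 1/a) ^ k ≥ 1 + k/a with the denominators cleared.
bernoulli : ∀ a k → a ^ k ℕ.* (a ℕ.+ k) ≤ a ℕ.* suc a ^ k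
bernoulli a zero    = ≤-reflexive (identity a)
  where
  identity : ∀ a → 1 ℕ.* (a ℕ.+ 0) ≡ a ℕ.* 1
  identity = solve-∀
bernoulli a (suc k) = begin
  a ^ suc k ℕ.* (a ℕ.+ suc k)              ≤⟨ m≤m+n _ (a ^ k ℕ.* k) ⟩
  a ^ suc k ℕ.* (a ℕ.+ suc k) ℕ.+ a ^ k ℕ.* k ≡⟨ identity (a ^ k) a k ⟩
  suc a ℕ.* (a ^ k ℕ.* (a ℕ.+ k))        ≤⟨ *-monoʳ-≤ (suc a) (bernoulli a k) ⟩
  suc a ℕ.* (a ℕ.* suc a ^ k)              ≡⟨ identity′ (suc a) a (suc a ^ k) ⟩
  a ℕ.* suc a ^ suc k                      ∎
  where
  open ≤-Reasoning
  identity : ∀ p a k → a ℕ.* p ℕ.* (a ℕ.+ suc k) ℕ.+ p ℕ.* k ≡ suc a ℕ.* (p ℕ.* (a ℕ.+ k))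
  identity = solve-∀
  identity′ : ∀ b a p → b ℕ.* (a ℕ.* p) ≡ a ℕ.* (b ℕ.* p)
  identity′ = solve-∀

-- This is (1 + 1/N) ^ N ≥ 2, obtained from `bernoulli` with `k = N` by cancelling a factor `N`.
2*N^N≤[1+N]^N : ∀ N .{{_ : NonZero N}} → 2 ℕ.* N ^ N ≤ suc N ^ N
2*N^N≤[1+N]^N N = *-cancelˡ-≤ N (begin
  N ℕ.* (2 ℕ.* N ^ N)   ≡⟨ identity N (N ^ N) ⟩
  N ^ N ℕ.* (N ℕ.+ N)   ≤⟨ bernoulli N N ⟩
  N ℕ.* suc N ^ N       ∎)
  where
  open ≤-Reasoning
  identity : ∀ a p → a ℕ.* (2 ℕ.* p) ≡ p ℕ.* (a ℕ.+ a)
  identity = solve-∀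

-- The inequality `2*N^N≤[1+N]^N` raised to the power `L`: every block of `N` factors gains a factor
-- 2.
N^[N*L]*2^L≤[1+N]^[N*L] : ∀ N L .{{_ : NonZero N}} → N ^ (N ℕ.* L) ℕ.* 2 ^ L ≤ suc N ^ (N ℕ.* L)
N^[N*L]*2^L≤[1+N]^[N*L] N zero rewrite *-zeroʳ N = ≤-refl
N^[N*L]*2^L≤[1+N]^[N*L] N (suc L) = begin
  N ^ (N ℕ.* suc L) ℕ.* 2 ^ suc L
    ≡⟨ cong (λ e → N ^ e ℕ.* 2 ^ suc L) (*-suc N L) ⟩
  N ^ (N ℕ.+ N ℕ.* L) ℕ.* 2 ^ suc L
    ≡⟨ cong (ℕ._* 2 ^ suc L) (^-distribˡ-+-* N N (N ℕ.* L)) ⟩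
  N ^ N ℕ.* N ^ (N ℕ.* L) ℕ.* (2 ℕ.* 2 ^ L)
    ≡⟨ identity (N ^ N) (N ^ (N ℕ.* L)) (2 ^ L) ⟩
  (2 ℕ.* N ^ N) ℕ.* (N ^ (N ℕ.* L) ℕ.* 2 ^ L)
    ≤⟨ *-mono-≤ (2*N^N≤[1+N]^N N) (N^[N*L]*2^L≤[1+N]^[N*L] N L) ⟩
  suc N ^ N ℕ.* suc N ^ (N ℕ.* L)
    ≡⟨ ^-distribˡ-+-* (suc N) N (N ℕ.* L) ⟨
  suc N ^ (N ℕ.+ N ℕ.* L)
    ≡⟨ cong (suc N ^_) (*-suc N L) ⟨
  suc N ^ (N ℕ.* suc L) ∎
  where
  open ≤-Reasoning
  identity : ∀ p q r → p ℕ.* q ℕ.* (2 ℕ.* r) ≡ (2 ℕ.* p) ℕ.* (q ℕ.* r)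
  identity = solve-∀

-- Sums over lists.

module _ {a} {A : Set a} where
  sum-map-mono-≤ : {f g : A → ℕ} → (∀ x → f x ≤ g x) → ∀ xs → sum (map f xs) ≤ sum (map g xs)
  sum-map-mono-≤ f≤g []       = z≤n
  sum-map-mono-≤ f≤g (x ∷ xs) = +-mono-≤ (f≤g x) (sum-map-mono-≤ f≤g xs)

  sum-map-*ʳ : ∀ (f : A → ℕ) k xs → sum (map (λ x → f x ℕ.* k) xs) ≡ sum (map f xs) ℕ.* k
  sum-map-*ʳ f k []       = refl
  sum-map-*ʳ f k (x ∷ xs) =
    trans (cong (f x ℕ.* k ℕ.+_) (sum-map-*ʳ f k xs)) (sym (*-distribʳ-+ k (f x) _))

  sum-map-const1 : ∀ xs → sum (map (λ (_ : A) → 1) xs) ≡ length xs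
  sum-map-const1 []       = refl
  sum-map-const1 (x ∷ xs) = cong suc (sum-map-const1 xs)

-- Path lengths in series-parallel DAGs.

depth : Dag → ℕ
depth empty     = 0
depth operation = 1
depth (d ⨾ e)   = depth d ℕ.+ depth e
depth (d ∥ e)   = depth d ⊔ depth e

mutual
  -- Edges of `d ⨾ e` never lead back from `e` to `d`, and edges of `d ∥ e` stay on their side. A
  -- path therefore splits into a piece in `d` followed by a piece in `e`, or lies in a single
  -- branch.
  path-length≤depth : ∀ d → DepthAtMost (depth d) d
  path-length≤depth operation x _ (stop _)    = ≤-refl
  path-length≤depth (d ⨾ e) (inj₁ x) k p =
    let i , j , q , j≤ , eq = split-⨾ p
    in ≤-trans (≤-reflexive eq) (+-mono-≤ (path-length≤depth d x i q) j≤)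
  path-length≤depth (d ⨾ e) (inj₂ y) k p =
    ≤-trans (path-length≤depth e y k (restrict-⨾ʳ p)) (m≤n+m _ (depth d))
  path-length≤depth (d ∥ e) (inj₁ x) k p =
    ≤-trans (path-length≤depth d x k (restrict-∥ˡ p)) (m≤m⊔n (depth d) _)
  path-length≤depth (d ∥ e) (inj₂ y) k p =
    ≤-trans (path-length≤depth e y k (restrict-∥ʳ p)) (m≤n⊔m (depth d) _)

  restrict-⨾ʳ : ∀ {d e y k} → Path (d ⨾ e) (inj₂ y) k → Path e y k
  restrict-⨾ʳ (stop _)          = stop _
  restrict-⨾ʳ (step (seqʳ a) p) = step a (restrict-⨾ʳ p)

  restrict-∥ˡ : ∀ {d e x k} → Path (d ∥ e) (inj₁ x) k → Path d x k
  restrict-∥ˡ (stop _)          = stop _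
  restrict-∥ˡ (step (parˡ a) p) = step a (restrict-∥ˡ p)

  restrict-∥ʳ : ∀ {d e x k} → Path (d ∥ e) (inj₂ x) k → Path e x k
  restrict-∥ʳ (stop _)          = stop _
  restrict-∥ʳ (step (parʳ a) p) = step a (restrict-∥ʳ p)

  -- The piece in `e` is represented only by a bound on its length `j`, because it may be missing
  -- and a `Path` has at least one node.
  split-⨾ : ∀ {d e x k} → Path (d ⨾ e) (inj₁ x) k →
          ∃[ i ] ∃[ j ] (Path d x i × j ≤ depth e × k ≡ i ℕ.+ j)
  split-⨾ (stop _)          = 1 , 0 , stop _ , z≤n , refl
  split-⨾ (step (seqˡ a) p) =
    let i , j , q , j≤ , eq = split-⨾ p in suc i , j , step a q , j≤ , cong suc eq
  split-⨾ {e = e} (step (across {y = y}) p) =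
    1 , _ , stop _ , path-length≤depth e y _ (restrict-⨾ʳ p) , refl

-- Effects and depth of programs.

updateAt-elim : ∀ {a p n} {A : Set a} (P : A → Set p) (i j : Fin n) {f : A → A} (xs : Vector A n) →
  (i ≡ j → P (f (xs i))) → P (xs i) → P (updateAt xs j f i)
updateAt-elim P i j xs updated minimal with i Fin.≟ j
... | yes refl = subst P (sym (updateAt-updates i xs)) (updated refl)
... | no i≢j   = subst P (sym (updateAt-minimal i j xs i≢j)) minimal

module Programs (n : ℕ) where
  open Machine n

  private variable
    a b p q : Level
    A : Set a
    B : Set b

  value : A × Memory n × Dag → A
  value = proj₁

  memory : A × Memory n × Dag → Memory n
  memory = proj₁ ∘ proj₂

  cost : A × Memory n × Dag → ℕ
  cost = depth ∘ proj₂ ∘ proj₂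

  -- The bound is uniform in the memory, so it applies to a later piece of a program whatever the
  -- earlier pieces wrote.
  Cost≤ : ℕ → M A → Set
  Cost≤ b p = ∀ m → cost (p m) ≤ b

  parMap-cost : ∀ {b} (f : A → M B) → (∀ x → Cost≤ b (f x)) → ∀ xs → Cost≤ b (parMap f xs)
  parMap-cost f f≤b []       m = z≤n
  parMap-cost f f≤b (x ∷ xs) m = ⊔-lub (f≤b x m) (parMap-cost f f≤b xs _)

  forAll-cost : ∀ {b} (f : A → M ⊤) → (∀ x → Cost≤ b (f x)) → ∀ xs → Cost≤ b (forAll xs f)
  forAll-cost f f≤b xs m = ≤-trans (≤-reflexive (+-identityʳ _)) (parMap-cost f f≤b xs m)

  when-cost : ∀ {b} c (p : M ⊤) → Cost≤ b p → Cost≤ b (when c p)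
  when-cost true  p p≤b = p≤b
  when-cost false p p≤b = λ _ → z≤n

  length-parMap : ∀ (f : A → M B) xs m → length (value (parMap f xs m)) ≡ length xs
  length-parMap f []       m = refl
  length-parMap f (x ∷ xs) m = cong suc (length-parMap f xs _)

  -- For branches that only read: each one leaves `m` as it was, so the next one starts in `m`
  -- again.
  parMap-pure : ∀ (f : A → M B) (g : A → B) m →
    (∀ x → value (f x m) ≡ g x) → (∀ x → memory (f x m) ≡ m) →
    ∀ xs → value (parMap f xs m) ≡ map g xs × memory (parMap f xs m) ≡ m
  parMap-pure f g m val mem [] = refl , refl
  parMap-pure f g m val mem (x ∷ xs) rewrite mem x =
    let vals , mems = parMap-pure f g m val mem xs in cong₂ _∷_ (val x) vals , mems

  parMap-invariant : (f : A → M B) (I : Memory n → Set p) →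
    (∀ x m → I m → I (memory (f x m))) →
    ∀ xs m → I m → I (memory (parMap f xs m))
  parMap-invariant f I preserved []       m Im = Im
  parMap-invariant f I preserved (x ∷ xs) m Im =
    parMap-invariant f I preserved xs _ (preserved x m Im)

  -- The branch of `x` achieves `Q x` and no other branch destroys it. Hence, once that branch has
  -- run, `I` together with `Q x` is an invariant of the remaining ones.
  parMap-establishes : (f : A → M B) (I : Memory n → Set p) (Q : A → Memory n → Set q) →
    (∀ x m → I m → I (memory (f x m))) →
    (∀ x m → I m → Q x (memory (f x m))) →
    (∀ x y m → I m → Q y m → Q y (memory (f x m))) →
    ∀ xs m → I m → All (λ x → Q x (memory (parMap f xs m))) xs
  parMap-establishes f I Q preserved established kept []       m Im = []
  parMap-establishes f I Q preserved established kept (x ∷ xs) m Im =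
    proj₂ (parMap-invariant f (λ m → I m × Q x m)
             (λ y m (Im , Qm) → preserved y m Im , kept y x m Im Qm)
             xs _ (preserved x m Im , established x m Im))
    ∷ parMap-establishes f I Q preserved established kept xs _ (preserved x m Im)

  length-pairUp : ∀ xs → length (pairUp xs) ≡ ⌈ length xs /2⌉
  length-pairUp []           = refl
  length-pairUp (x ∷ [])     = refl
  length-pairUp (x ∷ y ∷ xs) = cong suc (length-pairUp xs)

  sum-pairUp : ∀ xs → sum (map (λ (x , y) → x ℕ.+ y) (pairUp xs)) ≡ sum xs
  sum-pairUp []           = refl
  sum-pairUp (x ∷ [])     = +-identityʳ (x ℕ.+ 0)
  sum-pairUp (x ∷ y ∷ xs) = trans (cong (x ℕ.+ y ℕ.+_) (sum-pairUp xs)) (+-assoc x y (sum xs))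

  length≤1⇒head≡sum : ∀ xs → length xs ≤ 1 → fromMaybe 0 (head xs) ≡ sum xs
  length≤1⇒head≡sum []           _ = refl
  length≤1⇒head≡sum (x ∷ [])     _ = sym (+-identityʳ x)
  length≤1⇒head≡sum (x ∷ y ∷ xs) (s≤s ())

  -- A round halves the length, rounding up, and so lowers `⌈log₂ length xs ⌉` by one, while
  -- `pairUp` preserves the sum. After `k` rounds at most one entry is left; if there is none, the
  -- default 0 is the empty sum.
  reduceRounds-pure : ∀ k xs m → ⌈log₂ length xs ⌉ ≤ k →
    fromMaybe 0 (head (value (reduceRounds k xs m))) ≡ sum xs × memory (reduceRounds k xs m) ≡ m
  reduceRounds-pure zero    xs m len≤ = length≤1⇒head≡sum xs (⌈log₂⌉≤0⇒≤1 _ len≤) , refl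
  reduceRounds-pure (suc k) xs m len≤ =
    let add = λ (x , y) → x ℕ.+ y
        vals , mems = parMap-pure (compute ∘ add) add m (λ _ → refl) (λ _ → refl) (pairUp xs)
        len = begin
          ⌈log₂ length (map add (pairUp xs)) ⌉  ≡⟨ cong ⌈log₂_⌉ (List.length-map add (pairUp xs)) ⟩
          ⌈log₂ length (pairUp xs) ⌉            ≡⟨ cong ⌈log₂_⌉ (length-pairUp xs) ⟩
          ⌈log₂ ⌈ length xs /2⌉ ⌉               ≡⟨ ⌈log₂⌈n/2⌉⌉≡⌈log₂n⌉∸1 (length xs) ⟩
          ⌈log₂ length xs ⌉ ∸ 1                 ≤⟨ ∸-monoˡ-≤ 1 len≤ ⟩
          k                                     ∎
        value≡ , memory≡ = reduceRounds-pure k (map add (pairUp xs)) m len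
        rounds = λ ys m′ → reduceRounds k ys m′
    in trans (cong₂ (λ ys m′ → fromMaybe 0 (head (value (rounds ys m′)))) vals mems)
             (trans value≡ (sum-pairUp xs))
     , trans (cong₂ (λ ys m′ → memory (rounds ys m′)) vals mems) memory≡
    where open ≤-Reasoning

  reduceRounds-cost : ∀ k xs → Cost≤ k (reduceRounds k xs)
  reduceRounds-cost zero    xs m = z≤n
  reduceRounds-cost (suc k) xs m =
    +-mono-≤ (parMap-cost _ (λ _ _ → ≤-refl) (pairUp xs) m) (reduceRounds-cost k _ _)

  -- Parallel branches share the bound `b`, and the number of rounds depends only on the length of
  -- the list, which `parMap` preserves.
  parMap-reduce-cost : ∀ {b} (f : A → M ℕ) → (∀ x → Cost≤ b (f x)) → ∀ xs →
    Cost≤ (b ℕ.+ ⌈log₂ length xs ⌉) (parMap f xs >>= reduce)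
  parMap-reduce-cost f f≤b xs m = +-mono-≤ (parMap-cost f f≤b xs m) (begin
    -- The summand 0 is the `empty` DAG of the `return` that ends `reduce`.
    cost (reduceRounds ⌈log₂ length ys ⌉ ys m′) ℕ.+ 0  ≡⟨ +-identityʳ _ ⟩
    cost (reduceRounds ⌈log₂ length ys ⌉ ys m′)        ≤⟨ reduceRounds-cost _ ys m′ ⟩
    ⌈log₂ length ys ⌉                                  ≡⟨ cong ⌈log₂_⌉ (length-parMap f xs m) ⟩
    ⌈log₂ length xs ⌉                                  ∎)
    where
    open ≤-Reasoning
    ys = value (parMap f xs m)
    m′ = memory (parMap f xs m)

  parMap-reduce-pure : ∀ (f : A → M ℕ) g m →
    (∀ x → value (f x m) ≡ g x) → (∀ x → memory (f x m) ≡ m) →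
    ∀ xs → value ((parMap f xs >>= reduce) m) ≡ sum (map g xs)
         × memory ((parMap f xs >>= reduce) m) ≡ m
  parMap-reduce-pure f g m val mem xs =
    let vals , mems = parMap-pure f g m val mem xs
        value≡ , memory≡ = reduceRounds-pure _ (map g xs) m ≤-refl
    in trans (cong₂ (λ ys m′ → value (reduce ys m′)) vals mems) value≡
     , trans (cong₂ (λ ys m′ → memory (reduce ys m′)) vals mems) memory≡

  -- Loops with a geometrically shrinking measure.

  module _ (N : ℕ) (guard : M Bool) (body : M ⊤) (μ : Memory n → ℕ)
           (value≡ : ∀ m → value (guard m) ≡ (0 ℕ.<ᵇ μ m)) (memory≡ : ∀ m → memory (guard m) ≡ m)
           (shrinks : ∀ m → 0 ℕ.< μ m → μ (memory (body m)) ℕ.* suc N ≤ μ m ℕ.* N)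
           {B : ℕ} (guard≤B : Cost≤ B guard) (body≤B : Cost≤ B body) where

    -- With f iterations left μ m < (1 + 1/N) ^ f, so μ m = 0 when f = 0.
    while-terminates : ∀ f m → N ^ f ℕ.* μ m ℕ.< suc N ^ f →
      ∃[ k ] ∃[ m′ ] ∃[ d ] (While guard body m k m′ d × k ≤ f × depth d ≤ B ℕ.+ f ℕ.* (B ℕ.+ B))
    while-terminates f m potential with μ m in μ≡
    ... | zero = 0 , _ , _
      , exit (cong (_, proj₂ (guard m)) (trans (value≡ m) (cong (0 ℕ.<ᵇ_) μ≡)))
      , z≤n , ≤-trans (guard≤B m) (m≤m+n B _)
    while-terminates zero m (s≤s ()) | suc _
    while-terminates (suc f) m potential | suc s =
      let k , m′ , d , loop , k≤f , d≤ = while-terminates f m₂ potential′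
      in suc k , m′ , _
       , iterate (cong (_, proj₂ (guard m)) (trans (value≡ m) (cong (0 ℕ.<ᵇ_) μ≡))) refl loop
       , s≤s k≤f
       , (begin
           cost (guard m) ℕ.+ (cost (body m₁) ℕ.+ depth d)
             ≤⟨ +-mono-≤ (guard≤B m) (+-mono-≤ (body≤B m₁) d≤) ⟩
           B ℕ.+ (B ℕ.+ (B ℕ.+ f ℕ.* (B ℕ.+ B)))
             ≡⟨ cong (B ℕ.+_) (+-assoc B B _) ⟨
           B ℕ.+ suc f ℕ.* (B ℕ.+ B) ∎)
      where
      open ≤-Reasoning
      m₁ = memory (guard m)
      m₂ = memory (body m₁)
      factor : ∀ a b p → a ℕ.* (p ℕ.* b) ≡ p ℕ.* (b ℕ.* a)
      factor = solve-∀
      unfactor : ∀ a b p → p ℕ.* (b ℕ.* a) ≡ (a ℕ.* p) ℕ.* b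
      unfactor = solve-∀
      μ₁≡ : μ m₁ ≡ suc s
      μ₁≡ = trans (cong μ (memory≡ m)) μ≡
      0<μ₁ : 0 ℕ.< μ m₁
      0<μ₁ = subst (0 ℕ.<_) (sym μ₁≡) (s≤s z≤n)
      potential′ : N ^ f ℕ.* μ m₂ ℕ.< suc N ^ f
      potential′ = *-cancelˡ-< (suc N) _ _ (begin-strict
        suc N ℕ.* (N ^ f ℕ.* μ m₂)  ≡⟨ factor (suc N) (μ m₂) (N ^ f) ⟩
        N ^ f ℕ.* (μ m₂ ℕ.* suc N)  ≤⟨ *-monoʳ-≤ (N ^ f) (shrinks m₁ 0<μ₁) ⟩
        N ^ f ℕ.* (μ m₁ ℕ.* N)      ≡⟨ cong (λ x → N ^ f ℕ.* (x ℕ.* N)) μ₁≡ ⟩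
        N ^ f ℕ.* (suc s ℕ.* N)     ≡⟨ unfactor N (suc s) (N ^ f) ⟩
        N ^ suc f ℕ.* suc s         <⟨ potential ⟩
        suc N ^ suc f               ∎)

-- The summand 1 makes the conclusion hold also for S = 0.
cancel-sum : ∀ t S a b → t ℕ.* suc (S ℕ.* a) ≤ S ℕ.* b → t ℕ.* a ≤ b
cancel-sum t zero      a b t≤0 rewrite ℕ.*-identityʳ t | n≤0⇒n≡0 t≤0 = z≤n
cancel-sum t S@(suc _) a b t[1+Sa]≤Sb = *-cancelˡ-≤ S (begin
  S ℕ.* (t ℕ.* a)      ≡⟨ identity S t a ⟩
  t ℕ.* (S ℕ.* a)      ≤⟨ *-monoʳ-≤ t (n≤1+n (S ℕ.* a)) ⟩
  t ℕ.* suc (S ℕ.* a)  ≤⟨ t[1+Sa]≤Sb ⟩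
  S ℕ.* b              ∎)
  where
  open ≤-Reasoning
  identity : ∀ S t a → S ℕ.* (t ℕ.* a) ≡ t ℕ.* (S ℕ.* a)
  identity = solve-∀

-- The effect of one iteration of ADG.

module Analysis {c ℓ₁ ℓ₂} (K : ArchimedeanField c ℓ₁ ℓ₂) (ε : ArchimedeanField.Carrier K)
                {n : ℕ} (G : SimpleGraph n) where
  open ArchimedeanField K using (1#; _+_; _*_; _⁻¹; fromℕ; _≤?_) renaming (_≤_ to _≤ᴷ_)
  open OrderedField K using (below-threshold)
  open SimpleGraph G using (neighbours)
  open Algorithm K ε G
  open Programs n
  open Memory

  size ΣD : Memory n → ℕ
  size m = sum (map (λ v → if U m v then 1 else 0) V)
  ΣD m = sum (map (λ v → if U m v then D m v else 0) V)

  low : ℕ → ℕ → ℕ → Bool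
  low s S d = ⌊ fromℕ d ≤? (1# + ε) * (fromℕ s ⁻¹ * fromℕ S) ⌋

  countU-pure : ∀ m → value (countU m) ≡ size m × memory (countU m) ≡ m
  countU-pure m = parMap-reduce-pure _ _ m (λ _ → refl) (λ _ → refl) V

  sumDOverU-pure : ∀ m → value (sumDOverU m) ≡ ΣD m × memory (sumDOverU m) ≡ m
  sumDOverU-pure m = parMap-reduce-pure _ _ m (λ _ → refl) (λ _ → refl) V

  size≤n : ∀ m → size m ≤ n
  size≤n m = begin
    size m                    ≤⟨ sum-map-mono-≤ (λ v → indicator≤1 (U m v)) V ⟩
    sum (map (const 1) V)     ≡⟨ sum-map-const1 V ⟩
    length V                  ≡⟨ List.length-tabulate id ⟩
    n                         ∎
    where
    open ≤-Reasoning
    indicator≤1 : ∀ b → (if b then 1 else 0) ≤ 1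
    indicator≤1 true  = ≤-refl
    indicator≤1 false = z≤n

  when-invariant : ∀ {p} (I : Memory n → Set p) b {q : M ⊤} {m} →
    (b ≡ true → I (memory (q m))) → (b ≡ false → I m) → I (memory (when b q m))
  when-invariant I true  h h′ = h refl
  when-invariant I false h h′ = h′ refl

  -- As `V` lists every vertex, `Q` holds at all of them after the loop. The argument `conclude`
  -- turns this into the precondition `P` of the next loop, so that loops chain without naming the
  -- memories between them.
  parMap-V-establishes : ∀ {b p q r} {B : Set b} {f : Fin n → M B}
    (I : Memory n → Set p) (Q : Fin n → Memory n → Set q) (P : Memory n → Set r) →
    (∀ x m → I m → I (memory (f x m))) →
    (∀ x m → I m → Q x (memory (f x m))) →
    (∀ x y m → I m → Q y m → Q y (memory (f x m))) →
    (∀ m → I m → (∀ x → Q x m) → P m) →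
    ∀ {m} → I m → P (memory (parMap f V m))
  parMap-V-establishes I Q P preserved established kept conclude {m} Im =
    conclude _ (parMap-invariant _ I preserved V m Im)
      (λ x → All.lookup (parMap-establishes _ I Q preserved established kept V m Im) (∈-allFin x))

  -- The loops of the body appear in reverse order; Marked holds from the computation of R on.
  body-survivors′ : ∀ m →
    let m₁ = memory (countU m)
        m₂ = memory (sumDOverU m₁)
    in ∀ u → U (memory (body m)) u ≡ true →
       U m₂ u ≡ true × low (value (countU m)) (value (sumDOverU m₁)) (D m₂ u) ≡ false
  body-survivors′ m =
    parMap-invariant _ Survivors
      (λ x m′ h → when-invariant Survivors (R m′ x) (λ _ → h) (λ _ → h)) V _
    (parMap-V-establishes Marked (λ u m′ → U m′ u ≡ true → R m′ u ≡ false) Survivors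
      (λ x m′ h → when-invariant Marked (R m′ x)
        (λ _ u → updateAt-elim (λ b → b ≡ true → _) u x (U m′) (λ _ ()) (h u)) (λ _ → h))
      (λ x m′ h → when-invariant (λ m′ → U m′ x ≡ true → R m′ x ≡ false) (R m′ x)
        (λ _ Ux → contradiction (trans (sym (updateAt-updates x (U m′))) Ux) λ ()) (λ r _ → r))
      (λ x y m′ _ h → when-invariant (λ m′ → U m′ y ≡ true → R m′ y ≡ false) (R m′ x)
        (λ _ → updateAt-elim (λ b → b ≡ true → _) y x (U m′) (λ _ ()) h) (λ _ → h))
      (λ m′ h removed u Uu → let U₂u , lowu = h u Uu in U₂u , lowu (removed u Uu))
    -- The decrements change only the current `D`, while `Marked` refers to the values in `m₂`.
    (parMap-invariant _ Marked
      (λ x m′ h → when-invariant Marked (R m′ x)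
        (λ _ → parMap-invariant _ Marked
          (λ y m″ h → when-invariant Marked (U m″ y) (λ _ → h) (λ _ → h)) (neighbours x) m′ h)
        (λ _ → h)) V _
    (parMap-V-establishes (λ m′ → U m′ ≡ U m₂ × D m′ ≡ D m₂)
      (λ u m′ → R m′ u ≡ U m₂ u ∧ low s S (D m₂ u)) Marked
      (λ x m′ h → h)
      (λ { x m′ (refl , refl) → updateAt-updates x (R m′) })
      (λ { x y m′ (refl , refl) h → updateAt-elim (_≡ _) y x (R m′) (λ { refl → refl }) h })
      -- Once `U m₂ u` is `true`, the bit `U m₂ u ∧ low s S (D m₂ u)` stored in `R` reduces to
      -- `low s S (D m₂ u)`.
      (λ { m′ (refl , refl) h u Uu → Uu ,
            λ notR → trans (cong (_∧ low s S (D m₂ u)) (sym Uu)) (trans (sym (h u)) notR) })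
      (refl , refl))))
    where
    m₁ = memory (countU m)
    m₂ = memory (sumDOverU m₁)
    s = value (countU m)
    S = value (sumDOverU m₁)
    Survivors Marked : Memory n → Set
    Survivors m′ = ∀ u → U m′ u ≡ true → U m₂ u ≡ true × low s S (D m₂ u) ≡ false
    Marked m′ = ∀ u → U m′ u ≡ true → U m₂ u ≡ true × (R m′ u ≡ false → low s S (D m₂ u) ≡ false)

  -- The two reductions only read, so the values and the memory that they hand on can be replaced,
  -- all three at once, by `size m`, `ΣD m` and `m`.
  body-survivors : ∀ m u → U (memory (body m)) u ≡ true →
    U m u ≡ true × low (size m) (ΣD m) (D m u) ≡ false
  body-survivors m u Uu =
    let m₁ = memory (countU m)
        size≡ , m₁≡m = countU-pure m
        ΣD≡ , m₂≡m₁ = sumDOverU-pure m₁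
    in subst (λ (s , S , m₂) → U m₂ u ≡ true × low s S (D m₂ u) ≡ false)
         (cong₂ _,_ size≡ (cong₂ _,_ (trans ΣD≡ (cong ΣD m₁≡m)) (trans m₂≡m₁ m₁≡m)))
         (body-survivors′ m u Uu)

  -- Depth of the pieces of ADG.

  private
    r = ⌈log₂ n ⌉
    length-V : length V ≡ n
    length-V = List.length-tabulate id

  countU-cost : Cost≤ (2 ℕ.+ r) countU
  countU-cost = subst (λ l → Cost≤ (2 ℕ.+ ⌈log₂ l ⌉) countU) length-V
    (parMap-reduce-cost _ (λ _ _ → ≤-refl) V)

  sumDOverU-cost : Cost≤ (3 ℕ.+ r) sumDOverU
  sumDOverU-cost = subst (λ l → Cost≤ (3 ℕ.+ ⌈log₂ l ⌉) sumDOverU) length-V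
    (parMap-reduce-cost _ (λ _ _ → ≤-refl) V)

  degree-cost : ∀ v → Cost≤ (1 ℕ.+ r) (degree v)
  degree-cost v m = ≤-trans (parMap-reduce-cost _ (λ _ _ → ≤-refl) (neighbours v) m)
    (s≤s (⌈log₂⌉-mono-≤ (subst (length (neighbours v) ≤_) length-V (List.length-filter _ V))))

  initialize-cost : Cost≤ (4 ℕ.+ r) initialize
  initialize-cost m = ≤-trans
    (+-mono-≤ (forAll-cost _ (λ _ _ → ≤-refl) V m)
    (+-mono-≤ (forAll-cost _ (λ v m → +-mono-≤ (degree-cost v m) ≤-refl) V _) ≤-refl))
    (≤-reflexive (identity r))
    where
    identity : ∀ r → 1 ℕ.+ ((1 ℕ.+ r ℕ.+ 1) ℕ.+ 1) ≡ 4 ℕ.+ r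
    identity = solve-∀

  nonEmptyU-cost : Cost≤ (3 ℕ.+ r) nonEmptyU
  nonEmptyU-cost m = ≤-trans (+-monoˡ-≤ 1 (countU-cost m)) (≤-reflexive (+-comm (2 ℕ.+ r) 1))

  -- The statements of `body`, in program order, contribute 2 + 3 + 1 + 4 + 3 + 2 + 1 + 2 + 1 = 19,
  -- and each of the two reductions adds `r`.
  body-cost : Cost≤ (19 ℕ.+ (r ℕ.+ r)) body
  body-cost m = ≤-trans
    (+-mono-≤ (countU-cost m)
    (+-mono-≤ (sumDOverU-cost _)
    (+-mono-≤ (≤-refl {1})
    (+-mono-≤ (forAll-cost _ (λ _ _ → ≤-refl {4}) V _)
    (+-mono-≤ (forAll-cost _ (λ v m → s≤s (when-cost {2} (R m v) _ (forAll-cost _ (λ u m →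
        s≤s (when-cost {1} (U m u) (decrementD u) (λ _ → ≤-refl) m)) (neighbours v)) m)) V _)
    (+-mono-≤ (forAll-cost _ (λ v m → s≤s (when-cost {1} (R m v) _ (λ _ → ≤-refl) m)) V _)
    (+-mono-≤ (≤-refl {1})
    (+-mono-≤ (forAll-cost _ (λ v m → s≤s (when-cost {1} (R m v) _ (λ _ → ≤-refl) m)) V _)
    (≤-refl {1})))))))))
    (≤-reflexive (identity r))
    where
    identity : ∀ r → (2 ℕ.+ r) ℕ.+ ((3 ℕ.+ r) ℕ.+ 14) ≡ 19 ℕ.+ (r ℕ.+ r)
    identity = solve-∀

  -- Number of iterations and total depth.

  module _ (N : ℕ) {{_ : NonZero N}} (1≤Nε : 1# ≤ᴷ fromℕ N * ε) where

    -- The contrapositive of `below-threshold`: it carries a failed Boolean test in the field over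
    -- to the natural numbers.
    ¬low⇒< : ∀ s S d .{{_ : NonZero s}} → low s S d ≡ false → S ℕ.* suc N ℕ.< d ℕ.* (s ℕ.* N)
    ¬low⇒< s S d lowd = ≰⇒> λ le → contradiction
      (trans (sym lowd) (isYes≡true (below-threshold N s S d 1≤Nε le))) λ ()
      where
      isYes≡true : ∀ {x y} → x ≤ᴷ y → ⌊ x ≤? y ⌋ ≡ true
      isYes≡true {x} {y} x≤y = trans (isYes≗does (x ≤? y)) (dec-true (x ≤? y) x≤y)

    -- Markov's inequality with weights: each survivor carries at least `suc (S ℕ.* suc N)` of the
    -- total `S ℕ.* (s ℕ.* N)`, and `cancel-sum` removes `S`.
    size-shrinks : ∀ m → 0 ℕ.< size m → size (memory (body m)) ℕ.* suc N ≤ size m ℕ.* N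
    size-shrinks m 0<size =
      cancel-sum (size (memory (body m))) S (suc N) (s ℕ.* N) (begin
        size (memory (body m)) ℕ.* suc (S ℕ.* suc N)                        ≡⟨ sum-map-*ʳ _ _ V ⟨
        sum (map (λ u → (if U (memory (body m)) u then 1 else 0) ℕ.* suc (S ℕ.* suc N)) V)
          ≤⟨ sum-map-mono-≤ (λ u → weigh u (U (memory (body m)) u) (body-survivors m u)) V ⟩
        sum (map (λ u → (if U m u then D m u else 0) ℕ.* (s ℕ.* N)) V)      ≡⟨ sum-map-*ʳ _ _ V ⟩
        S ℕ.* (s ℕ.* N) ∎)
      where
      open ≤-Reasoning
      s = size m
      S = ΣD m
      instance _ = ℕ.>-nonZero 0<size
      -- The strict bound of `¬low⇒<` is by definition a bound on the successor, which is the weight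
      -- of a survivor; any other vertex has weight 0 on the left.
      weigh : ∀ u b → (b ≡ true → U m u ≡ true × low s S (D m u) ≡ false) →
        (if b then 1 else 0) ℕ.* suc (S ℕ.* suc N) ≤ (if U m u then D m u else 0) ℕ.* (s ℕ.* N)
      weigh u false _ = z≤n
      weigh u true  h rewrite proj₁ (h refl) | ℕ.*-identityˡ (suc (S ℕ.* suc N)) =
        ¬low⇒< s S (D m u) (proj₂ (h refl))

    iterations : ℕ
    iterations = N ℕ.* suc ⌊log₂ n ⌋

    -- `size m` is below 2 to the power `suc ⌊log₂ n ⌋`, and that many blocks of `N` iterations
    -- supply just this power of 2.
    initial-potential : ∀ m → N ^ iterations ℕ.* size m ℕ.< suc N ^ iterations
    initial-potential m = begin-strict
      N ^ iterations ℕ.* size m                <⟨ *-monoʳ-< (N ^ iterations) {{m^n≢0 N iterations}}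
                                                    (≤-<-trans (size≤n m) (n<2^[1+⌊log₂n⌋] n)) ⟩
      N ^ iterations ℕ.* 2 ^ suc ⌊log₂ n ⌋     ≤⟨ N^[N*L]*2^L≤[1+N]^[N*L] N (suc ⌊log₂ n ⌋) ⟩
      suc N ^ iterations                       ∎
      where open ≤-Reasoning

    ADG-bounds : ∀ m → ∃[ k ] ∃[ m′ ] ∃[ d ]
      (ADG m k m′ d
       × k ≤ N ℕ.* 2 ℕ.* log n
       × DepthAtMost ((29 ℕ.+ N ℕ.* 2 ℕ.* 46) ℕ.* (log n ℕ.* log n)) d)
    ADG-bounds m =
      let k , m′ , d , loop , k≤ , d≤ = while-terminates N nonEmptyU body size
            (λ m → cong (0 ℕ.<ᵇ_) (proj₁ (countU-pure m))) (λ m → proj₂ (countU-pure m))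
            size-shrinks guard≤ body-cost
            iterations (memory (initialize m)) (initial-potential (memory (initialize m)))
      in k , m′ , _ , run refl loop , ≤-trans k≤ iterations≤
       , λ x l p → ≤-trans (path-length≤depth _ x l p) (total d d≤)
      where
      open ≤-Reasoning
      L = log n
      -- `while-terminates` takes a single bound for guard and body; the bound of `body-cost` covers
      -- the cheaper guard too.
      B = 19 ℕ.+ (r ℕ.+ r)
      guard≤ : Cost≤ B nonEmptyU
      guard≤ m = ≤-trans (nonEmptyU-cost m) (+-mono-≤ (m≤m+n 3 16) (m≤m+n r r))
      iterations≤ : iterations ≤ N ℕ.* 2 ℕ.* L
      iterations≤ = ≤-trans (*-monoʳ-≤ N (1+⌊log₂n⌋≤2*log n)) (≤-reflexive (sym (ℕ.*-assoc N 2 L)))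
      1≤L : 1 ≤ L
      1≤L = m≤m⊔n 1 ⌊log₂ n ⌋
      r≤2L : r ≤ 2 ℕ.* L
      r≤2L = ≤-trans (⌈log₂⌉≤1+⌊log₂⌋ n) (1+⌊log₂n⌋≤2*log n)
      constant : ∀ k → k ≤ k ℕ.* L
      constant k = ≤-trans (≤-reflexive (sym (ℕ.*-identityʳ k))) (*-monoʳ-≤ k 1≤L)
      B≤ : B ≤ 23 ℕ.* L
      B≤ = ≤-trans (+-mono-≤ (constant 19) (+-mono-≤ r≤2L r≤2L)) (≤-reflexive (identity L))
        where
        identity : ∀ L → 19 ℕ.* L ℕ.+ (2 ℕ.* L ℕ.+ 2 ℕ.* L) ≡ 23 ℕ.* L
        identity = solve-∀
      initialize≤ : 4 ℕ.+ r ≤ 6 ℕ.* L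
      initialize≤ = ≤-trans (+-mono-≤ (constant 4) r≤2L) (≤-reflexive (sym (*-distribʳ-+ L 4 2)))
      total : ∀ d → depth d ≤ B ℕ.+ iterations ℕ.* (B ℕ.+ B) →
        cost (initialize m) ℕ.+ depth d ≤ (29 ℕ.+ N ℕ.* 2 ℕ.* 46) ℕ.* (L ℕ.* L)
      total d d≤ = begin
        cost (initialize m) ℕ.+ depth d
          ≤⟨ +-mono-≤ (≤-trans (initialize-cost m) initialize≤)
               (≤-trans d≤ (+-mono-≤ B≤ (*-mono-≤ iterations≤ (+-mono-≤ B≤ B≤)))) ⟩
        -- 6 is for the initialization, and each 23 is for a guard or a body: first the guard that
        -- ends the loop, then both in every iteration.
        6 ℕ.* L ℕ.+ (23 ℕ.* L ℕ.+ N ℕ.* 2 ℕ.* L ℕ.* (23 ℕ.* L ℕ.+ 23 ℕ.* L))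
          ≡⟨ identity N L ⟩
        29 ℕ.* L ℕ.+ N ℕ.* 2 ℕ.* 46 ℕ.* (L ℕ.* L)
          -- Here `constant L` reads `L ≤ L ℕ.* L`.
          ≤⟨ +-monoˡ-≤ _ (*-monoʳ-≤ 29 (constant L)) ⟩
        29 ℕ.* (L ℕ.* L) ℕ.+ N ℕ.* 2 ℕ.* 46 ℕ.* (L ℕ.* L)
          ≡⟨ *-distribʳ-+ (L ℕ.* L) 29 (N ℕ.* 2 ℕ.* 46) ⟨
        (29 ℕ.+ N ℕ.* 2 ℕ.* 46) ℕ.* (L ℕ.* L) ∎
        where
        identity : ∀ N L → 6 ℕ.* L ℕ.+ (23 ℕ.* L ℕ.+ N ℕ.* 2 ℕ.* L ℕ.* (23 ℕ.* L ℕ.+ 23 ℕ.* L))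
          ≡ 29 ℕ.* L ℕ.+ N ℕ.* 2 ℕ.* 46 ℕ.* (L ℕ.* L)
        identity = solve-∀

lemma1 : ∀ {c ℓ₁ ℓ₂} (K : ArchimedeanField c ℓ₁ ℓ₂) →
    let open ArchimedeanField K in
    (ε : Carrier) → 0# < ε →
    ∃[ C₁ ] ∃[ C₂ ]
    ((n : ℕ) (G : SimpleGraph n) (m : Memory n) →
    let open Algorithm K ε G in
    ∃[ k ] ∃[ m′ ] ∃[ d ]
    (ADG m k m′ d
    × k ℕ.≤ C₁ ℕ.* log n
    × DepthAtMost (C₂ ℕ.* (log n ℕ.* log n)) d))
lemma1 K ε 0<ε =
  -- `N` is chosen from `ε` alone, before the graph is given, so both constants are uniform in `n`
  -- and `G`.
  let N , N≢0 , 1≤Nε = OrderedField.reciprocal-bound K 0<ε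
  in N ℕ.* 2 , 29 ℕ.+ N ℕ.* 2 ℕ.* 46 ,
     λ n G m → Analysis.ADG-bounds K ε G N {{N≢0}} 1≤Nε m
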